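{- Let $G$ be a connected graph with $\Delta(G)\geq 3$ and let $n$ be a positive integer with $n>2$. Then $\chi(G^{\frac{2}{n}})=\Delta(G)+1=\omega(G^{\frac{2}{n}})$.
   Context: All graphs are finite and simple; $\Delta$ is the maximum degree, $\chi$ the chromatic number, $\omega$ the clique number. For a graph $H$ and $m\in\mathbb{N}$, the $m$-power $H^m$ has vertex set $V(H)$, with distinct vertices $x,y$ adjacent iff $1\le d_H(x,y)\le m$. For $n\in\mathbb{N}$, the $n$-subdivision $G^{\frac1n}$ is obtained from $G$ by replacing each edge by a path of length $n$. The fractional power $G^{\frac{m}{n}}$ is $(G^{\frac1n})^m$ (the fraction is not reduced: $G^{\frac2n}$ is the square of the $n$-subdivision). -}

module Defs where

open import Data.Nat using (ℕ; zero; suc; _≤_; _<_; _⊔_; _∸_)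
open import Data.Fin using (Fin; toℕ)
open import Data.List using (List; length; filterᵇ; map; foldr; allFin)
open import Data.Bool using (Bool; true; false)
open import Data.Sum using (_⊎_; inj₁; inj₂)
open import Data.Product using (Σ; _×_; _,_; proj₁; proj₂; ∃-syntax)
open import Relation.Binary.PropositionalEquality using (_≡_; _≢_)
open import Relation.Nullary using (¬_)

record Graph : Set where
  field
    order  : ℕ
    adj    : Fin order → Fin order → Bool
    sym    : ∀ x y → adj x y ≡ adj y x
    irrefl : ∀ x → adj x x ≡ false
open Graph public

deg : (G : Graph) → Fin (order G) → ℕ
deg G x = length (filterᵇ (adj G x) (allFin (order G)))

Δ : Graph → ℕ
Δ G = foldr _⊔_ 0 (map (deg G) (allFin (order G)))

data Walk {V : Set} (E : V → V → Set) : V → V → ℕ → Set where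
  nil  : ∀ {x} → Walk E x x 0
  cons : ∀ {x y z k} → E x y → Walk E y z k → Walk E x z (suc k)

Connected : Graph → Set
Connected G = ∀ x y → ∃[ k ] Walk (λ u v → adj G u v ≡ true) x y k

-- edges of G, each listed once as (x , y) with x < y
Edge : Graph → Set
Edge G = Σ (Fin (order G) × Fin (order G))
           λ p → (toℕ (proj₁ p) < toℕ (proj₂ p)) × (adj G (proj₁ p) (proj₂ p) ≡ true)

src tgt : {G : Graph} → Edge G → Fin (order G)
src e = proj₁ (proj₁ e)
tgt e = proj₂ (proj₁ e)

-- vertices: original vertices, plus n-1 internal vertices on every edge;
-- internal vertex (e , i) sits at distance (toℕ i + 1) from src e along the path
SubV : Graph → ℕ → Set
SubV G n = Fin (order G) ⊎ (Edge G × Fin (n ∸ 1))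

data SubAdj (G : Graph) (n : ℕ) : SubV G n → SubV G n → Set where
  direct : (e : Edge G) → n ≡ 1 → SubAdj G n (inj₁ (src {G} e)) (inj₁ (tgt {G} e))
  start  : (e : Edge G) (i : Fin (n ∸ 1)) → toℕ i ≡ 0 →
           SubAdj G n (inj₁ (src {G} e)) (inj₂ (e , i))
  mid    : (e : Edge G) (i j : Fin (n ∸ 1)) → toℕ j ≡ suc (toℕ i) →
           SubAdj G n (inj₂ (e , i)) (inj₂ (e , j))
  end    : (e : Edge G) (i : Fin (n ∸ 1)) → suc (toℕ i) ≡ n ∸ 1 →
           SubAdj G n (inj₂ (e , i)) (inj₁ (tgt {G} e))
  flip   : ∀ {u v} → SubAdj G n u v → SubAdj G n v u

-- m-th power of a graph given by an edge relation:
-- x ~ y iff x ≠ y and d(x,y) ≤ m, i.e. there is a walk of length ≤ m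

Power : {V : Set} → ℕ → (V → V → Set) → V → V → Set
Power m E x y = (x ≢ y) × (∃[ k ] (k ≤ m × Walk E x y k))

FracPow : (G : Graph) (m n : ℕ) → SubV G n → SubV G n → Set
FracPow G m n = Power m (SubAdj G n)

ProperColouring : {V : Set} → (V → V → Set) → ℕ → Set
ProperColouring {V} E k = Σ (V → Fin k) λ c → ∀ x y → E x y → c x ≢ c y

Clique : {V : Set} → (V → V → Set) → ℕ → Set
Clique {V} E k = Σ (Fin k → V) λ f → ∀ i j → i ≢ j → E (f i) (f j)

IsChromaticNumber : {V : Set} → (V → V → Set) → ℕ → Set
IsChromaticNumber E k = ProperColouring E k × (∀ j → j < k → ¬ ProperColouring E j)

IsCliqueNumber : {V : Set} → (V → V → Set) → ℕ → Set
IsCliqueNumber E k = Clique E k × (∀ j → k < j → ¬ Clique E j)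

{-# OPTIONS --safe #-}

-- The internal vertices next to a vertex of maximum degree form with it a
-- clique of size Δ + 1, so a proper (Δ + 1)-colouring settles both equalities.
-- Such a colouring is built from a colour for each vertex of G, distinct
-- remaining colours for the internal vertices around it, and a word along each
-- edge in which any three consecutive letters differ. Repeating the first three
-- letters of a word lengthens it by 3, which leaves the lengths 3, 4 and 5.
-- For length 5 the end letters only have to differ, so a greedy colouring
-- of G suffices. For lengths 3 and 4 all vertices of G get the same colour and
-- the two ends of each edge need distinct labels among the other Δ colours;
-- this is an edge Δ-colouring of the bipartite graph G^{1/2}, obtained by
-- switching Kempe chains as in König's theorem.
module Submission where

open import Defs
open import Data.Nat using (ℕ; suc; _≤_; _<_)
open import Data.Product using (_×_)

open import Data.Nat using (zero; s≤s; z≤n; _+_; _∸_; _<?_)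
open import Data.Nat.Properties
  using (≤-refl; ≤-reflexive; ≤-trans; <-asym; <⇒≤; <-irrefl; ≮⇒≥;
         m≤n⇒m≤n⊔o; m≤n⇒m≤o⊔n; +-monoˡ-<; m+[n∸m]≡n;
         ⊔-sel; <-irrelevant; suc-injective; 1+n≰n)
open import Data.Nat.Induction using (<-rec)
open import Data.Nat.GeneralisedArithmetic using (iterate)
open import Data.Fin using (Fin; zero; suc; toℕ; fromℕ<; inject≤; punchIn)
open import Data.Fin.Properties
  using (_≟_; any?; pigeonhole; ¬∀⟶∃¬; toℕ-injective; toℕ<n; toℕ-fromℕ<;
         inject≤-injective; punchIn-injective; punchInᵢ≢i; <-cmp; <⇒≢)
open import Data.Fin.Permutation.Components using (transpose; transpose-inverse)
open import Data.List using (List; []; _∷_; length; lookup; filterᵇ; map; allFin; cartesianProduct)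
open import Data.List.Properties using (foldr-preservesᵒ; length-map)
open import Data.List.Relation.Unary.Any as Any using (here; there)
open import Data.List.Relation.Unary.Any.Properties using (lookup-index)
import Data.List.Relation.Unary.All as All
open import Data.List.Relation.Unary.AllPairs using (_∷_)
open import Data.List.Relation.Unary.Unique.Propositional using (Unique)
import Data.List.Relation.Unary.Unique.Propositional.Properties as Unique
open import Data.List.Membership.Propositional using (_∈_; _∉_)
open import Data.List.Membership.Propositional.Properties
  using (∈-filter⁺; ∈-filter⁻; ∈-map⁺; ∈-map⁻; ∈-allFin; ∈-lookup;
         ∈-cartesianProduct⁺; foldr-selective)
open import Data.List.Membership.DecPropositional using (_∈?_)
open import Data.Bool using (true; T?)
open import Axiom.UniquenessOfIdentityProofs using (module Decidable⇒UIP)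
import Data.Bool.Properties as Bool
open import Data.Product using (∃; ∃-syntax; _,_; proj₁; proj₂)
open import Data.Empty using (⊥)
open import Data.Sum using (_⊎_; inj₁; inj₂; [_,_]′)
import Data.Sum as Sum
open import Function using (_∘_; Equivalence)
open import Relation.Nullary using (¬_; Dec; yes; no; contradiction)
open import Relation.Nullary.Decidable using (map′; _×-dec_)
open import Relation.Binary.Definitions using (Decidable; tri<; tri≈; tri>)
open import Relation.Binary.Construct.Closure.ReflexiveTransitive using (Star; ε; _◅_; _◅◅_)
open import Relation.Binary.PropositionalEquality as ≡
  using (_≡_; _≢_; refl; trans; cong; cong₂; subst; ≢-sym)

-- Finite sets

∉-head : ∀ {A : Set} {x y : A} {ys} → x ∉ y ∷ ys → x ≢ y
∉-head x∉ x≡y = x∉ (here x≡y)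

∉-tail : ∀ {A : Set} {x y : A} {ys} → x ∉ y ∷ ys → x ∉ ys
∉-tail x∉ x∈ = x∉ (there x∈)

lookup-injective : ∀ {A : Set} {xs : List A} → Unique xs →
                   ∀ i j → lookup xs i ≡ lookup xs j → i ≡ j
lookup-injective (_ ∷ _)   zero    zero    _  = refl
lookup-injective (x≢ ∷ _)  zero    (suc j) eq = contradiction eq (All.lookup x≢ (∈-lookup j))
lookup-injective (x≢ ∷ _)  (suc i) zero    eq = contradiction (≡.sym eq) (All.lookup x≢ (∈-lookup i))
lookup-injective (_ ∷ xs!) (suc i) (suc j) eq = cong suc (lookup-injective xs! i j eq)

index-injective : ∀ {A : Set} {x y : A} {xs} (p : x ∈ xs) (q : y ∈ xs) →
                  Any.index p ≡ Any.index q → x ≡ y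
index-injective {xs = xs} p q eq =
  trans (lookup-index p) (trans (cong (lookup xs) eq) (≡.sym (lookup-index q)))

-- If every colour occurred in the list, the positions of occurrence would inject `Fin k` into a
-- smaller set.
fresh : ∀ {k} (xs : List (Fin k)) → length xs < k → ∃ λ c → c ∉ xs
fresh {k} xs xs<k = ¬∀⟶∃¬ k (_∈ xs) (λ c → _∈?_ _≟_ c xs) not-all
  where
  not-all : ¬ (∀ c → c ∈ xs)
  not-all all with pigeonhole xs<k (Any.index ∘ all)
  ... | i , j , i<j , eq = <⇒≢ i<j (index-injective (all i) (all j) eq)

transpose-injective : ∀ {k} (i j : Fin k) {x y} → transpose i j x ≡ transpose i j y → x ≡ y
transpose-injective i j eq =
  trans (≡.sym (transpose-inverse j i)) (trans (cong (transpose j i) eq) (transpose-inverse j i))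

transpose-matchˡ : ∀ {k} (i j : Fin k) → transpose i j i ≡ j
transpose-matchˡ i j with i ≟ i
... | yes _  = refl
... | no i≢i = contradiction refl i≢i

transpose-matchʳ : ∀ {k} (i j : Fin k) → transpose i j j ≡ i
transpose-matchʳ i j with j ≟ i
... | yes j≡i = j≡i
... | no _ with j ≟ j
...   | yes _  = refl
...   | no j≢j = contradiction refl j≢j

transpose-mismatch : ∀ {k} {i j x : Fin k} → x ≢ i → x ≢ j → transpose i j x ≡ x
transpose-mismatch {i = i} {j} {x} x≢i x≢j with x ≟ i
... | yes x≡i = contradiction x≡i x≢i
... | no _ with x ≟ j
...   | yes x≡j = contradiction x≡j x≢j
...   | no _    = refl

-- Iterates of a function and decidable reachability

iterate-+ : ∀ {A : Set} (h : A → A) x i j → iterate h x (i + j) ≡ iterate h (iterate h x i) j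
iterate-+ h x zero    j = refl
iterate-+ h x (suc i) j = iterate-+ h (h x) i j

-- Strong induction on the exponent: two of the first N + 1 iterates coincide, and cutting out the
-- loop between them lowers any exponent above N without changing the value.
iterate-bounded : ∀ {N} (h : Fin N → Fin N) u k →
                  ∃ λ (i : Fin (suc N)) → iterate h u (toℕ i) ≡ iterate h u k
iterate-bounded {N} h u = <-rec _ bounded
  where
  bounded : ∀ k → (∀ {l} → l < k → ∃ λ (i : Fin (suc N)) → iterate h u (toℕ i) ≡ iterate h u l) →
            ∃ λ (i : Fin (suc N)) → iterate h u (toℕ i) ≡ iterate h u k
  bounded k rec with k <? suc N
  ... | yes k≤N = fromℕ< k≤N , cong (iterate h u) (toℕ-fromℕ< k≤N)
  ... | no  k≰N with pigeonhole ≤-refl (λ (i : Fin (suc N)) → iterate h u (toℕ i))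
  ...   | i , j , i<j , hⁱ≡hʲ = proj₁ shorter , trans (proj₂ shorter) shift
    where
    r = k ∸ toℕ j
    j+r≡k : toℕ j + r ≡ k
    j+r≡k = m+[n∸m]≡n (≤-trans (<⇒≤ (toℕ<n j)) (≮⇒≥ k≰N))
    shorter = rec (subst (toℕ i + r <_) j+r≡k (+-monoˡ-< r i<j))
    shift : iterate h u (toℕ i + r) ≡ iterate h u k
    shift = trans (iterate-+ h u (toℕ i) r)
              (trans (cong (λ x → iterate h x r) hⁱ≡hʲ)
                (trans (≡.sym (iterate-+ h u (toℕ j) r)) (cong (iterate h u) j+r≡k)))

-- `Star` is built from the front, whereas the Kempe argument looks at the last step, to see how a
-- vertex was entered.
unsnoc : ∀ {A : Set} {R : A → A → Set} {u x} → Star R u x →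
         u ≡ x ⊎ (∃ λ z → Star R u z × R z x)
unsnoc ε = inj₁ refl
unsnoc (r ◅ rs) with unsnoc rs
... | inj₁ refl          = inj₂ (_ , ε , r)
... | inj₂ (z , rs′ , s) = inj₂ (z , r ◅ rs′ , s)

module _ {N} {R : Fin N → Fin N → Set} (R? : Decidable R)
         (functional : ∀ {x y z} → R x y → R x z → y ≡ z) where

  private
    -- Points without a successor are fixed, which makes the function total and adds only empty
    -- paths.
    next : Fin N → Fin N
    next x with any? (R? x)
    ... | yes (y , _) = y
    ... | no _        = x

    next-complete : ∀ {x y} → R x y → next x ≡ y
    next-complete {x} {y} r with any? (R? x)
    ... | yes (_ , s) = functional s r
    ... | no ¬r       = contradiction (y , r) ¬r

    next-sound : ∀ x → Star R x (next x)
    next-sound x with any? (R? x)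
    ... | yes (_ , r) = r ◅ ε
    ... | no _        = ε

    iterate-sound : ∀ x k → Star R x (iterate next x k)
    iterate-sound x zero    = ε
    iterate-sound x (suc k) = next-sound x ◅◅ iterate-sound (next x) k

    iterate-complete : ∀ {x y} → Star R x y → ∃ λ k → iterate next x k ≡ y
    iterate-complete ε = 0 , refl
    iterate-complete (r ◅ rs) with iterate-complete rs
    ... | k , eq = suc k , trans (cong (λ z → iterate next z k) (next-complete r)) eq

  reachable? : Decidable (Star R)
  reachable? u x = map′ sound complete (any? λ (i : Fin (suc N)) → iterate next u (toℕ i) ≟ x)
    where
    sound : (∃ λ (i : Fin (suc N)) → iterate next u (toℕ i) ≡ x) → Star R u x
    sound (i , eq) = subst (Star R u) eq (iterate-sound u (toℕ i))
    complete : Star R u x → ∃ λ (i : Fin (suc N)) → iterate next u (toℕ i) ≡ x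
    complete rs with iterate-complete rs
    ... | k , eq with iterate-bounded next u k
    ...   | i , eq′ = i , trans eq′ eq

-- Degrees and greedy colouring

module _ (G : Graph) where

  private
    V : Set
    V = Fin (order G)

  Adj : V → V → Set
  Adj x y = adj G x y ≡ true

  Adj-sym : ∀ {x y} → Adj x y → Adj y x
  Adj-sym {x} {y} xy = trans (Graph.sym G y x) xy

  Adj⇒≢ : ∀ {x y} → Adj x y → x ≢ y
  Adj⇒≢ {x} xx refl with trans (≡.sym xx) (irrefl G x)
  ... | ()

  neighbours : V → List V
  neighbours x = filterᵇ (adj G x) (allFin (order G))

  ∈-neighbours⁺ : ∀ {x y} → Adj x y → y ∈ neighbours x
  ∈-neighbours⁺ {x} {y} xy =
    ∈-filter⁺ (T? ∘ adj G x) (∈-allFin y) (Equivalence.from Bool.T-≡ xy)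

  ∈-neighbours⁻ : ∀ {x y} → y ∈ neighbours x → Adj x y
  ∈-neighbours⁻ {x} y∈ =
    Equivalence.to Bool.T-≡ (proj₂ (∈-filter⁻ (T? ∘ adj G x) {xs = allFin (order G)} y∈))

  deg≤Δ : ∀ x → deg G x ≤ Δ G
  deg≤Δ x = foldr-preservesᵒ
    (λ a b → [ m≤n⇒m≤n⊔o b , m≤n⇒m≤o⊔n a ]′) 0 _
    (inj₂ (Any.map ≤-reflexive (∈-map⁺ (deg G) (∈-allFin x))))

  Δ-attained : 0 < Δ G → ∃ λ x → deg G x ≡ Δ G
  Δ-attained 0<Δ with foldr-selective ⊔-sel 0 (map (deg G) (allFin (order G)))
  ... | inj₁ Δ≡0 = contradiction (subst (0 <_) Δ≡0 0<Δ) λ ()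
  ... | inj₂ Δ∈ with ∈-map⁻ (deg G) Δ∈
  ...   | x , _ , Δ≡deg = x , ≡.sym Δ≡deg

  -- The new vertex avoids the current colours of all its neighbours, inside the list or not. There
  -- are at most Δ of them, so one of the Δ + 1 colours is free.
  greedy : (xs : List V) →
           ∃ λ (f : V → Fin (suc (Δ G))) → ∀ {y z} → y ∈ xs → z ∈ xs → Adj y z → f y ≢ f z
  greedy [] = (λ _ → zero) , λ ()
  greedy (x ∷ xs) with greedy xs
  ... | f , proper
    with fresh (map f (neighbours x))
           (s≤s (subst (_≤ Δ G) (≡.sym (length-map f (neighbours x))) (deg≤Δ x)))
  ...   | c , c∉ = f′ , proper′
    where
    f′ : V → Fin (suc (Δ G))
    f′ y with y ≟ x
    ... | yes _ = c
    ... | no _  = f y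
    c≢f : ∀ {y} → Adj x y → c ≢ f y
    c≢f xy c≡ = c∉ (subst (_∈ map f (neighbours x)) (≡.sym c≡) (∈-map⁺ f (∈-neighbours⁺ xy)))
    old : ∀ {y} → y ∈ x ∷ xs → y ≢ x → y ∈ xs
    old (here y≡x) y≢x = contradiction y≡x y≢x
    old (there y∈) _   = y∈
    proper′ : ∀ {y z} → y ∈ x ∷ xs → z ∈ x ∷ xs → Adj y z → f′ y ≢ f′ z
    proper′ {y} {z} y∈ z∈ yz with y ≟ x | z ≟ x
    ... | yes refl | yes refl = contradiction refl (Adj⇒≢ yz)
    ... | yes refl | no _     = c≢f yz
    ... | no _     | yes refl = ≢-sym (c≢f (Adj-sym yz))
    ... | no y≢x   | no z≢x   = proper (old y∈ y≢x) (old z∈ z≢x) yz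

-- Labels of half-edges

  -- label x y is the label of the half of the edge xy at x; it is junk when x
  -- and y are not adjacent.
  record Labelling (k : ℕ) : Set where
    field
      label     : V → V → Fin k
      injective : ∀ {x y z} → Adj x y → Adj x z → label x y ≡ label x z → y ≡ z

  open Labelling

  -- The half-edge of x towards y is numbered by the position of y in the neighbour list of x.
  -- Nothing relates the two labels on one edge.
  indexLabelling : 0 < Δ G → Labelling (Δ G)
  indexLabelling 0<Δ = record { label = lab ; injective = inj }
    where
    lab : V → V → Fin (Δ G)
    lab x y with _∈?_ _≟_ y (neighbours x)
    ... | yes y∈ = inject≤ (Any.index y∈) (deg≤Δ x)
    ... | no _   = fromℕ< 0<Δ
    inj : ∀ {x y z} → Adj x y → Adj x z → lab x y ≡ lab x z → y ≡ z
    inj {x} {y} {z} xy xz eq with _∈?_ _≟_ y (neighbours x) | _∈?_ _≟_ z (neighbours x)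
    ... | yes y∈ | yes z∈ = index-injective y∈ z∈ (inject≤-injective (deg≤Δ x) (deg≤Δ x) _ _ eq)
    ... | no y∉  | _      = contradiction (∈-neighbours⁺ xy) y∉
    ... | yes _  | no z∉  = contradiction (∈-neighbours⁺ xz) z∉

  -- Kempe switching

  module _ {k} (L : Labelling k) {u v : V} (uv : Adj u v)
           (conflict : label L u v ≡ label L v u) {d : Fin k} (d≢c : d ≢ label L u v) where

    private
      c : Fin k
      c = label L u v

    -- When c and d are exchanged at x, the half-edge of x labelled d gets the
    -- label c and comes into conflict with the c at its other end y.
    Pushes : V → V → Set
    Pushes x y = Adj x y × label L x y ≡ d × label L y x ≡ c

    Pushes? : Decidable Pushes
    Pushes? x y = (adj G x y Bool.≟ true) ×-dec (label L x y ≟ d) ×-dec (label L y x ≟ c)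

    Pushes-functional : ∀ {x y z} → Pushes x y → Pushes x z → y ≡ z
    Pushes-functional (xy , dy , _) (xz , dz , _) = injective L xy xz (trans dy (≡.sym dz))

    -- These are u and the other vertices of G on the alternating path of the 2-subdivision that
    -- leaves u by its half-edge labelled d.
    Chain : V → Set
    Chain = Star Pushes u

    -- Bipartiteness enters here: after u, the chain enters each vertex of G by a half-edge labelled
    -- c. At v that half-edge leads to u, but the half at u is labelled c and not d.
    v∉Chain : ¬ Chain v
    v∉Chain uv* with unsnoc uv*
    ... | inj₁ u≡v = Adj⇒≢ uv u≡v
    ... | inj₂ (z , _ , zv , lzv≡d , lvz≡c)
      with injective L (Adj-sym zv) (Adj-sym uv) (trans lvz≡c conflict)
    ...   | refl = d≢c (≡.sym lzv≡d)

    -- Only the half at x changes. If its label was c, then either y precedes x in the chain, or x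
    -- is u and y is v, where the other half has label c and not d. If its label was d, a new
    -- conflict would mean that x pushes y into the chain.
    switched-mixed : ∀ {x y} → Chain x → ¬ Chain y → Adj x y → label L x y ≢ label L y x →
                     transpose c d (label L x y) ≢ label L y x
    switched-mixed {x} {y} x∈ y∉ xy lxy≢lyx eq = by-label (label L x y ≟ c) (label L x y ≟ d)
      where
      by-label : Dec (label L x y ≡ c) → Dec (label L x y ≡ d) → ⊥
      by-label (yes lxy≡c) _ = from-pred (unsnoc x∈)
        where
        lyx≡d : label L y x ≡ d
        lyx≡d = trans (≡.sym eq) (trans (cong (transpose c d) lxy≡c) (transpose-matchˡ c d))
        from-pred : ¬ (u ≡ x ⊎ (∃ λ z → Chain z × Pushes z x))
        from-pred (inj₁ refl) with injective L xy uv lxy≡c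
        ... | refl = d≢c (trans (≡.sym lyx≡d) (≡.sym conflict))
        from-pred (inj₂ (z , z∈ , zx , _ , lxz≡c))
          with injective L (Adj-sym zx) xy (trans lxz≡c (≡.sym lxy≡c))
        ... | refl = y∉ z∈
      by-label (no _) (yes lxy≡d) = y∉ (x∈ ◅◅ ((xy , lxy≡d , lyx≡c) ◅ ε))
        where
        lyx≡c : label L y x ≡ c
        lyx≡c = trans (≡.sym eq) (trans (cong (transpose c d) lxy≡d) (transpose-matchʳ c d))
      by-label (no lxy≢c) (no lxy≢d) =
        lxy≢lyx (trans (≡.sym (transpose-mismatch lxy≢c lxy≢d)) eq)

    -- Exchanging c and d at a whole vertex keeps the labels there distinct. The exchange takes
    -- place at u but not at v, which resolves their conflict.
    switch : ∃ λ (L′ : Labelling k) →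
             label L′ u v ≢ label L′ v u ×
             (∀ {x y} → Adj x y → label L x y ≢ label L y x → label L′ x y ≢ label L′ y x)
    switch = record { label = lab ; injective = inj } , resolved , preserved
      where
      Chain? : ∀ x → Dec (Chain x)
      Chain? = reachable? Pushes? Pushes-functional u
      lab : V → V → Fin k
      lab x y with Chain? x
      ... | yes _ = transpose c d (label L x y)
      ... | no _  = label L x y
      inj : ∀ {x y z} → Adj x y → Adj x z → lab x y ≡ lab x z → y ≡ z
      inj {x} xy xz eq with Chain? x
      ... | yes _ = injective L xy xz (transpose-injective c d eq)
      ... | no _  = injective L xy xz eq
      resolved : lab u v ≢ lab v u
      resolved eq with Chain? u | Chain? v
      ... | no u∉ | _      = u∉ ε
      ... | _     | yes v∈ = v∉Chain v∈
      ... | yes _ | no _   = d≢c (trans (≡.sym (transpose-matchˡ c d)) (trans eq (≡.sym conflict)))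
      preserved : ∀ {x y} → Adj x y → label L x y ≢ label L y x → lab x y ≢ lab y x
      preserved {x} {y} xy lxy≢lyx eq with Chain? x | Chain? y
      ... | yes _  | yes _  = lxy≢lyx (transpose-injective c d eq)
      ... | yes x∈ | no y∉  = switched-mixed x∈ y∉ xy lxy≢lyx eq
      ... | no x∉  | yes y∈ = switched-mixed y∈ x∉ (Adj-sym xy) (≢-sym lxy≢lyx) (≡.sym eq)
      ... | no _   | no _   = lxy≢lyx eq

  -- A switch repairs one edge and creates no conflict elsewhere, so a single pass over the pairs
  -- suffices.
  resolve : ∀ {k} → 2 ≤ k → Labelling k → (ps : List (V × V)) →
            ∃ λ (L : Labelling k) → ∀ {x y} → (x , y) ∈ ps → Adj x y → label L x y ≢ label L y x
  resolve 2≤k L₀ [] = L₀ , λ ()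
  resolve 2≤k L₀ ((u , v) ∷ ps) with resolve 2≤k L₀ ps
  ... | L , good with adj G u v Bool.≟ true | label L u v ≟ label L v u
  ...   | no ¬uv | _ = L , λ { (here refl) uv → contradiction uv ¬uv ; (there p) → good p }
  ...   | yes _  | no ok = L , λ { (here refl) _ → ok ; (there p) → good p }
  ...   | yes uv | yes conflict with fresh (label L u v ∷ []) 2≤k
  ...     | d , d∉ with switch L uv conflict (∉-head d∉)
  ...       | L′ , resolved , preserved =
    L′ , λ { (here refl) _ → resolved ; (there p) xy → preserved xy (good p xy) }

  conflictFreeLabelling : 2 ≤ Δ G →
    ∃ λ (L : Labelling (Δ G)) → ∀ {x y} → Adj x y → label L x y ≢ label L y x
  conflictFreeLabelling 2≤Δ
    with resolve 2≤Δ (indexLabelling (<⇒≤ 2≤Δ)) (cartesianProduct (allFin _) (allFin _))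
  ... | L , good = L , λ {x} {y} → good (∈-cartesianProduct⁺ (∈-allFin x) (∈-allFin y))

-- Words along a subdivided edge

-- Only the letters at positions 0, …, m + 1 matter.
record Filling {k} (m : ℕ) (p a b q : Fin k) : Set where
  field
    word        : ℕ → Fin k
    first       : word 0 ≡ p
    second      : word 1 ≡ a
    penultimate : word m ≡ b
    last        : word (suc m) ≡ q
    gap₁        : ∀ i → i ≤ m → word i ≢ word (suc i)
    gap₂        : ∀ i → i < m → word i ≢ word (suc (suc i))

open Filling

-- The triples of consecutive letters that are added are rotations of the first three letters of the
-- old word.
repeatPrefix : ∀ {k m} {p a b q : Fin k} → 2 ≤ m → Filling m p a b q → Filling (3 + m) p a b q
repeatPrefix {k} {m} 2≤m F = record
  { word = w ; first = first F ; second = second F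
  ; penultimate = penultimate F ; last = last F ; gap₁ = g₁ ; gap₂ = g₂ }
  where
  w : ℕ → Fin k
  w 0                   = word F 0
  w 1                   = word F 1
  w 2                   = word F 2
  w (suc (suc (suc i))) = word F i
  0<m = ≤-trans (s≤s z≤n) 2≤m
  g₁ : ∀ i → i ≤ 3 + m → w i ≢ w (suc i)
  g₁ 0 _ = gap₁ F 0 z≤n
  g₁ 1 _ = gap₁ F 1 0<m
  g₁ 2 _ = ≢-sym (gap₂ F 0 0<m)
  g₁ (suc (suc (suc i))) (s≤s (s≤s (s≤s i≤m))) = gap₁ F i i≤m
  g₂ : ∀ i → i < 3 + m → w i ≢ w (suc (suc i))
  g₂ 0 _ = gap₂ F 0 0<m
  g₂ 1 _ = ≢-sym (gap₁ F 0 z≤n)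
  g₂ 2 _ = ≢-sym (gap₁ F 1 0<m)
  g₂ (suc (suc (suc i))) (s≤s (s≤s (s≤s i<m))) = gap₂ F i i<m

filling₃ : ∀ {k} {p a b : Fin k} → p ≢ a → p ≢ b → a ≢ b → Filling 2 p a b p
filling₃ {p = p} {a} {b} p≢a p≢b a≢b = record
  { word = λ { 0 → p ; 1 → a ; 2 → b ; _ → p }
  ; first = refl ; second = refl ; penultimate = refl ; last = refl
  ; gap₁ = λ { 0 _ → p≢a ; 1 _ → a≢b ; 2 _ → ≢-sym p≢b
             ; (suc (suc (suc _))) (s≤s (s≤s ())) }
  ; gap₂ = λ { 0 _ → p≢b ; 1 _ → ≢-sym p≢a
             ; (suc (suc _)) (s≤s (s≤s ())) } }

module _ {k} (4≤k : 4 ≤ k) where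

  -- The middle letter lies within distance 2 of all the others; as both ends carry p, only three
  -- letters are to be avoided.
  filling₄ : ∀ {p a b : Fin k} → p ≢ a → p ≢ b → a ≢ b → Filling 3 p a b p
  filling₄ {p} {a} {b} p≢a p≢b a≢b with fresh (p ∷ a ∷ b ∷ []) 4≤k
  ... | x , x∉ = record
    { word = λ { 0 → p ; 1 → a ; 2 → x ; 3 → b ; _ → p }
    ; first = refl ; second = refl ; penultimate = refl ; last = refl
    ; gap₁ = λ { 0 _ → p≢a ; 1 _ → ≢-sym x≢a ; 2 _ → x≢b ; 3 _ → ≢-sym p≢b
               ; (suc (suc (suc (suc _)))) (s≤s (s≤s (s≤s ()))) }
    ; gap₂ = λ { 0 _ → ≢-sym x≢p ; 1 _ → a≢b ; 2 _ → x≢p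
               ; (suc (suc (suc _))) (s≤s (s≤s (s≤s ()))) } }
    where
    x≢p = ∉-head x∉
    x≢a = ∉-head (∉-tail x∉)
    x≢b = ∉-head (∉-tail (∉-tail x∉))

  -- These are the middle letters of p a x y b q. Chosen separately, they can clash only in a colour
  -- outside p, q, a, b, and then one of them is replaced.
  middlePair : ∀ {p q a b : Fin k} → p ≢ q → p ≢ a → q ≢ b →
    ∃ λ x → ∃ λ y → x ≢ y × (x ≢ p × x ≢ a × x ≢ b) × (y ≢ q × y ≢ a × y ≢ b)
  middlePair {p} {q} {a} {b} p≢q p≢a q≢b
    with fresh (p ∷ a ∷ b ∷ []) 4≤k | fresh (q ∷ a ∷ b ∷ []) 4≤k
  ... | x , x∉ | y , y∉ with x ≟ y
  ...   | no x≢y =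
    x , y , x≢y , (∉-head x∉ , ∉-head (∉-tail x∉) , ∉-head (∉-tail (∉-tail x∉)))
                , (∉-head y∉ , ∉-head (∉-tail y∉) , ∉-head (∉-tail (∉-tail y∉)))
  ...   | yes refl with ∉-head x∉ | ∉-head y∉ | ∉-head (∉-tail x∉) | ∉-head (∉-tail (∉-tail x∉))
  ...     | x≢p | x≢q | x≢a | x≢b with p ≟ b | q ≟ a
  -- Either p can serve as y or q can serve as x, unless both p = b and q = a.
  ...       | no p≢b   | _        = x , p , x≢p , (x≢p , x≢a , x≢b) , (p≢q , p≢a , p≢b)
  ...       | yes refl | no q≢a   = q , x , ≢-sym x≢q , (≢-sym p≢q , q≢a , q≢b) , (x≢q , x≢a , x≢b)
  -- The word is now p q x z p q, so z has three letters to avoid.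
  ...       | yes refl | yes refl with fresh (x ∷ p ∷ q ∷ []) 4≤k
  ...         | z , z∉ =
    x , z , ≢-sym (∉-head z∉) , (x≢p , x≢a , x≢b) ,
    (∉-head (∉-tail (∉-tail z∉)) , ∉-head (∉-tail (∉-tail z∉)) , ∉-head (∉-tail z∉))

  filling₅ : ∀ {p q a b : Fin k} → p ≢ q → p ≢ a → q ≢ b → Filling 4 p a b q
  filling₅ {p} {q} {a} {b} p≢q p≢a q≢b with middlePair p≢q p≢a q≢b
  ... | x , y , x≢y , (x≢p , x≢a , x≢b) , (y≢q , y≢a , y≢b) = record
    { word = λ { 0 → p ; 1 → a ; 2 → x ; 3 → y ; 4 → b ; _ → q }
    ; first = refl ; second = refl ; penultimate = refl ; last = refl
    ; gap₁ = λ { 0 _ → p≢a ; 1 _ → ≢-sym x≢a ; 2 _ → x≢y ; 3 _ → y≢b ; 4 _ → ≢-sym q≢b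
               ; (suc (suc (suc (suc (suc _))))) (s≤s (s≤s (s≤s (s≤s ())))) }
    ; gap₂ = λ { 0 _ → ≢-sym x≢p ; 1 _ → ≢-sym y≢a ; 2 _ → x≢b ; 3 _ → y≢q
               ; (suc (suc (suc (suc _)))) (s≤s (s≤s (s≤s (s≤s ())))) } }

  -- The alternative depends only on t modulo 3, hence is the same for all edges: equal ends with
  -- distinct a and b, or distinct ends with no condition between a and b.
  fillings : ∀ t →
    (∀ {p a b : Fin k} → p ≢ a → p ≢ b → a ≢ b → Filling (2 + t) p a b p) ⊎
    (∀ {p q a b : Fin k} → p ≢ q → p ≢ a → q ≢ b → Filling (2 + t) p a b q)
  fillings 0 = inj₁ filling₃
  fillings 1 = inj₁ filling₄
  fillings 2 = inj₂ filling₅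
  fillings (suc (suc (suc t))) = Sum.map
    (λ F p≢a p≢b a≢b → repeatPrefix (s≤s (s≤s z≤n)) (F p≢a p≢b a≢b))
    (λ F p≢q p≢a q≢b → repeatPrefix (s≤s (s≤s z≤n)) (F p≢q p≢a q≢b))
    (fillings t)

-- The square of the subdivision

module _ (G : Graph) (m : ℕ) (2≤m : 2 ≤ m) where

  private
    V : Set
    V = Fin (order G)
    W : Set
    W = SubV G (suc m)

  -- Positions run from 0 at `src e` to m + 1 at `tgt e`, as in `word`, so that original and
  -- internal vertices are treated alike.
  data At (e : Edge G) : ℕ → W → Set where
    atSrc : At e 0 (inj₁ (src {G} e))
    atMid : ∀ i → At e (suc (toℕ i)) (inj₂ (e , i))
    atTgt : At e (suc m) (inj₁ (tgt {G} e))

  At-functional : ∀ {e j k u v} → At e j u → At e k v → j ≡ k → u ≡ v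
  At-functional atSrc     atSrc     _  = refl
  At-functional (atMid i) (atMid j) eq = cong (λ l → inj₂ (_ , l)) (toℕ-injective (suc-injective eq))
  At-functional (atMid i) atTgt     eq = contradiction (toℕ<n i) (<-irrefl (suc-injective eq))
  At-functional atTgt     (atMid j) eq = contradiction (toℕ<n j) (<-irrefl (≡.sym (suc-injective eq)))
  At-functional atTgt     atTgt     _  = refl

  Step : W → W → Set
  Step u v = ∃[ e ] ∃[ i ] (i ≤ m × At e i u × At e (suc i) v)

  SubAdj⇒Step : ∀ {u v} → SubAdj G (suc m) u v → Step u v ⊎ Step v u
  SubAdj⇒Step (direct e n≡1) = contradiction 2≤m λ 2≤m → m≢0 2≤m (suc-injective n≡1)
    where
    m≢0 : ∀ {m} → 2 ≤ m → m ≢ 0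
    m≢0 () refl
  SubAdj⇒Step (start e i i≡0) =
    inj₁ (e , 0 , z≤n , atSrc , subst (λ j → At e (suc j) _) i≡0 (atMid i))
  SubAdj⇒Step (mid e i j j≡1+i) =
    inj₁ (e , suc (toℕ i) , toℕ<n i , atMid i , subst (λ l → At e (suc l) _) j≡1+i (atMid j))
  SubAdj⇒Step (end e i 1+i≡m) =
    inj₁ (e , m , ≤-refl , subst (λ l → At e l _) 1+i≡m (atMid i) , atTgt)
  SubAdj⇒Step (flip uv) = Sum.swap (SubAdj⇒Step uv)

  -- Port v w u: the internal vertex u is next to v on the subdivided edge vw.
  data Port : V → V → W → Set where
    outgoing : ∀ e i → toℕ i ≡ 0 → Port (src {G} e) (tgt {G} e) (inj₂ (e , i))
    incoming : ∀ e i → suc (toℕ i) ≡ m → Port (tgt {G} e) (src {G} e) (inj₂ (e , i))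

  Port⇒Adj : ∀ {v w u} → Port v w u → Adj G v w
  Port⇒Adj (outgoing e _ _) = proj₂ (proj₂ e)
  Port⇒Adj (incoming e _ _) = Adj-sym G (proj₂ (proj₂ e))

  Port⇒SubAdj : ∀ {v w u} → Port v w u → SubAdj G (suc m) (inj₁ v) u
  Port⇒SubAdj (outgoing e i i≡0)   = start e i i≡0
  Port⇒SubAdj (incoming e i 1+i≡m) = flip (end e i 1+i≡m)

  Port-internal : ∀ {v w u x} → Port v w u → inj₁ x ≢ u
  Port-internal (outgoing _ _ _) ()
  Port-internal (incoming _ _ _) ()

  src≢tgt : ∀ (e : Edge G) → src {G} e ≢ tgt {G} e
  src≢tgt e eq = <-irrefl (cong toℕ eq) (proj₁ (proj₂ e))

  Port-far-end : ∀ {v w v′ w′ u} → Port v w u → Port v′ w′ u → v ≡ v′ → w ≡ w′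
  Port-far-end (outgoing e _ _) (outgoing _ _ _) _  = refl
  Port-far-end (outgoing e _ _) (incoming _ _ _) eq = contradiction eq (src≢tgt e)
  Port-far-end (incoming e _ _) (outgoing _ _ _) eq = contradiction (≡.sym eq) (src≢tgt e)
  Port-far-end (incoming e _ _) (incoming _ _ _) _  = refl

  Edge-≡ : ∀ {e e′ : Edge G} → src {G} e ≡ src {G} e′ → tgt {G} e ≡ tgt {G} e′ → e ≡ e′
  Edge-≡ {(x , y) , x<y , xy} {_ , x<y′ , xy′} refl refl =
    cong₂ (λ p q → (x , y) , p , q) (<-irrelevant x<y x<y′)
      (Decidable⇒UIP.≡-irrelevant Bool._≟_ xy xy′)

  -- Edges are stored with `src` below `tgt`, so an outgoing and an incoming port for the same
  -- ordered pair would give opposite strict inequalities.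
  Port-unique : ∀ {v w v′ w′ u u′} → Port v w u → Port v′ w′ u′ → v ≡ v′ → w ≡ w′ → u ≡ u′
  Port-unique (outgoing e i i≡0) (outgoing e′ j j≡0) v≡ w≡ =
    cong₂ (λ e l → inj₂ (e , l)) (Edge-≡ {e} {e′} v≡ w≡) (toℕ-injective (trans i≡0 (≡.sym j≡0)))
  Port-unique (outgoing e _ _) (incoming e′ _ _) v≡ w≡ =
    contradiction (≡.subst₂ (λ x y → toℕ x < toℕ y) (≡.sym w≡) (≡.sym v≡) (proj₁ (proj₂ e′)))
      (<-asym (proj₁ (proj₂ e)))
  Port-unique (incoming e _ _) (outgoing e′ _ _) v≡ w≡ =
    contradiction (≡.subst₂ (λ x y → toℕ x < toℕ y) (≡.sym v≡) (≡.sym w≡) (proj₁ (proj₂ e′)))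
      (<-asym (proj₁ (proj₂ e)))
  Port-unique (incoming e i 1+i≡m) (incoming e′ j 1+j≡m) v≡ w≡ =
    cong₂ (λ e l → inj₂ (e , l)) (Edge-≡ {e} {e′} w≡ v≡)
      (toℕ-injective (suc-injective (trans 1+i≡m (≡.sym 1+j≡m))))

  internal : ∀ {e j u} → At e j u → 0 < j → j ≤ m → ∃ λ i → u ≡ inj₂ (e , i) × suc (toℕ i) ≡ j
  internal (atMid i) _ _   = i , refl , refl
  internal atTgt     _ m<m = contradiction m<m 1+n≰n

  Step⇒Port : ∀ {v u} → Step u (inj₁ v) ⊎ Step (inj₁ v) u → ∃ λ w → Port v w u
  Step⇒Port (inj₁ (e , _ , _ , at-u , atTgt))
    with internal at-u (<⇒≤ 2≤m) ≤-refl
  ... | i , refl , 1+i≡m = _ , incoming e i 1+i≡m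
  Step⇒Port (inj₂ (e , _ , _ , atSrc , at-u))
    with internal at-u (s≤s z≤n) (<⇒≤ 2≤m)
  ... | i , refl , 1+i≡1 = _ , outgoing e i (suc-injective 1+i≡1)
  Step⇒Port (inj₂ (e , _ , m<m , atTgt , _)) = contradiction m<m 1+n≰n

  Step-internal : ∀ {e i u} → Step u (inj₂ (e , i)) ⊎ Step (inj₂ (e , i)) u →
                  At e (toℕ i) u ⊎ At e (suc (suc (toℕ i))) u
  Step-internal (inj₁ (_ , _ , _ , at-u , atMid _)) = inj₁ at-u
  Step-internal (inj₂ (_ , _ , _ , atMid _ , at-u)) = inj₂ at-u

  -- `punchIn (f x)` carries the labels at x injectively to the colours other than `f x`.
  portColour : ∀ {c} → (V → Fin (suc c)) → Labelling G c → V → V → Fin (suc c)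
  portColour f L x y = punchIn (f x) (Labelling.label L x y)

  module _ {c} (f : V → Fin (suc c)) (L : Labelling G c)
           (fill : ∀ {x y} → Adj G x y →
                   Filling m (f x) (portColour f L x y) (portColour f L y x) (f y)) where

    private
      wordOn : Edge G → ℕ → Fin (suc c)
      wordOn e = word (fill (proj₂ (proj₂ e)))

    -- Each edge uses only its filling from `src` to `tgt`, so the fillings for the two directions
    -- need not be reverses of each other.
    colour : W → Fin (suc c)
    colour (inj₁ x)       = f x
    colour (inj₂ (e , i)) = wordOn e (suc (toℕ i))

    colour-At : ∀ {e j u} → At e j u → colour u ≡ wordOn e j
    colour-At {e} atSrc = ≡.sym (first (fill (proj₂ (proj₂ e))))
    colour-At (atMid i) = refl
    colour-At {e} atTgt = ≡.sym (last (fill (proj₂ (proj₂ e))))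

    colour-Port : ∀ {v w u} → Port v w u → colour u ≡ portColour f L v w
    colour-Port (outgoing e i i≡0) =
      trans (cong (wordOn e ∘ suc) i≡0) (second (fill (proj₂ (proj₂ e))))
    colour-Port (incoming e i 1+i≡m) =
      trans (cong (wordOn e) 1+i≡m) (penultimate (fill (proj₂ (proj₂ e))))

    colour-Step : ∀ {u v} → Step u v → colour u ≢ colour v
    colour-Step (e , i , i≤m , at-u , at-v) eq =
      gap₁ (fill (proj₂ (proj₂ e))) i i≤m
        (trans (≡.sym (colour-At at-u)) (trans eq (colour-At at-v)))

    -- Around an original vertex z, both are ports of z and the labels at z are distinct. Around an
    -- internal z, they lie two positions apart on one path, which is `gap₂`.
    colour-Step² : ∀ z {u v} → u ≢ v → Step u z ⊎ Step z u → Step v z ⊎ Step z v →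
                   colour u ≢ colour v
    colour-Step² (inj₁ x) u≢v uz vz eq with Step⇒Port uz | Step⇒Port vz
    ... | w , pu | w′ , pv =
      u≢v (Port-unique pu pv refl (Labelling.injective L (Port⇒Adj pu) (Port⇒Adj pv)
        (punchIn-injective (f x) _ _
          (trans (≡.sym (colour-Port pu)) (trans eq (colour-Port pv))))))
    colour-Step² (inj₂ (e , i)) {u} {v} u≢v uz vz eq with Step-internal uz | Step-internal vz
    ... | inj₁ at-u | inj₁ at-v = u≢v (At-functional at-u at-v refl)
    ... | inj₂ at-u | inj₂ at-v = u≢v (At-functional at-u at-v refl)
    ... | inj₁ at-u | inj₂ at-v = gap₂ (fill (proj₂ (proj₂ e))) (toℕ i) (toℕ<n i)
      (trans (≡.sym (colour-At at-u)) (trans eq (colour-At at-v)))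
    ... | inj₂ at-u | inj₁ at-v = gap₂ (fill (proj₂ (proj₂ e))) (toℕ i) (toℕ<n i)
      (trans (≡.sym (colour-At at-v)) (trans (≡.sym eq) (colour-At at-u)))

    colour-proper : ProperColouring (FracPow G 2 (suc m)) (suc c)
    colour-proper = colour , proper
      where
      proper : ∀ u v → FracPow G 2 (suc m) u v → colour u ≢ colour v
      proper u .u (u≢u , _ , _ , nil) = contradiction refl u≢u
      proper u v (_ , _ , _ , cons uv nil) with SubAdj⇒Step uv
      ... | inj₁ s = colour-Step s
      ... | inj₂ s = ≢-sym (colour-Step s)
      proper u v (u≢v , _ , _ , cons {y = z} uz (cons zv nil)) =
        colour-Step² z u≢v (SubAdj⇒Step uz) (Sum.swap (SubAdj⇒Step zv))
      proper u v (_ , _ , s≤s (s≤s ()) , cons _ (cons _ (cons _ _)))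

  -- The clique around a vertex

  port : ∀ {v w} → Adj G v w → ∃ λ u → Port v w u
  port {v} {w} vw with <-cmp v w
  ... | tri< v<w _ _ = _ , outgoing ((v , w) , v<w , vw) (fromℕ< (<⇒≤ 2≤m)) (toℕ-fromℕ< (<⇒≤ 2≤m))
  ... | tri≈ _ v≡w _ = contradiction v≡w (Adj⇒≢ G vw)
  -- The stored edge runs from w to v, so the port of v is the last internal vertex, with index m -
  -- 1.
  ... | tri> _ _ w<v = last-internal (≤-trans (s≤s z≤n) 2≤m)
    where
    last-internal : 0 < m → ∃ λ u → Port v w u
    last-internal 0<m = _ , incoming ((w , v) , w<v , Adj-sym G vw) (fromℕ< pred<m) 1+pred≡m
      where
      pred<m : m ∸ 1 < m
      pred<m = ≤-reflexive (m+[n∸m]≡n 0<m)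
      1+pred≡m : suc (toℕ (fromℕ< pred<m)) ≡ m
      1+pred≡m = trans (cong suc (toℕ-fromℕ< pred<m)) (m+[n∸m]≡n 0<m)

  -- Any two ports of v are joined by a walk of length 2 through v, and they are distinct because
  -- their far ends are.
  starClique : ∀ v → Clique (FracPow G 2 (suc m)) (suc (deg G v))
  starClique v = vertex , adjacent
    where
    far : Fin (deg G v) → V
    far = lookup (neighbours G v)
    ports : ∀ i → ∃ λ u → Port v (far i) u
    ports i = port (∈-neighbours⁻ G (∈-lookup i))
    vertex : Fin (suc (deg G v)) → W
    vertex zero    = inj₁ v
    vertex (suc i) = proj₁ (ports i)
    toPort : ∀ i → SubAdj G (suc m) (inj₁ v) (vertex (suc i))
    toPort i = Port⇒SubAdj (proj₂ (ports i))
    far-injective : ∀ i j → far i ≡ far j → i ≡ j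
    far-injective = lookup-injective (Unique.filter⁺ (T? ∘ adj G v) (Unique.allFin⁺ (order G)))
    distinct : ∀ i j → vertex (suc i) ≡ vertex (suc j) → i ≡ j
    distinct i j eq = far-injective i j
      (Port-far-end (proj₂ (ports i)) (subst (Port v (far j)) (≡.sym eq) (proj₂ (ports j))) refl)
    adjacent : ∀ i j → i ≢ j → FracPow G 2 (suc m) (vertex i) (vertex j)
    adjacent zero    zero    i≢j = contradiction refl i≢j
    adjacent zero    (suc j) _   =
      Port-internal (proj₂ (ports j)) , 1 , s≤s z≤n , cons (toPort j) nil
    adjacent (suc i) zero    _   =
      ≢-sym (Port-internal (proj₂ (ports i))) , 1 , s≤s z≤n , cons (flip (toPort i)) nil
    adjacent (suc i) (suc j) i≢j =
      i≢j ∘ cong suc ∘ distinct i j , 2 , ≤-refl , cons (flip (toPort i)) (cons (toPort j) nil)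

-- This serves twice: as the lower bound on the chromatic number and as the upper bound on the
-- clique number.
clique≤colours : ∀ {A : Set} {E : A → A → Set} {j k} → j < k → Clique E k → ¬ ProperColouring E j
clique≤colours j<k (vertex , adjacent) (colour , proper) with pigeonhole j<k (colour ∘ vertex)
... | x , y , x<y , eq = proper _ _ (adjacent x y (<⇒≢ x<y)) eq

theorem3 : (G : Graph) → Connected G → 3 ≤ Δ G → (n : ℕ) → 2 < n →
    IsChromaticNumber (FracPow G 2 n) (suc (Δ G)) × IsCliqueNumber (FracPow G 2 n) (suc (Δ G))
theorem3 G _ 3≤Δ (suc m@(suc (suc t))) (s≤s 2≤m@(s≤s (s≤s _))) =
    (colouring , λ j j<k → clique≤colours j<k clique)
  , (clique , λ j k<j cl → clique≤colours k<j cl colouring)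
  where
  clique : Clique (FracPow G 2 (suc m)) (suc (Δ G))
  clique with Δ-attained G (≤-trans (s≤s z≤n) 3≤Δ)
  ... | v , deg≡Δ = subst (λ d → Clique (FracPow G 2 (suc m)) (suc d)) deg≡Δ (starClique G m 2≤m v)

  colouring : ProperColouring (FracPow G 2 (suc m)) (suc (Δ G))
  -- Δ ≥ 3 provides the four colours that the fillings require.
  colouring with fillings (s≤s 3≤Δ) t
  ... | inj₁ F with conflictFreeLabelling G (<⇒≤ 3≤Δ)
  -- All vertices of G get the colour `zero`, and the ports get successors, so only the two ports of
  -- each edge have to be compared.
  ...   | L , good = colour-proper G m 2≤m (λ _ → zero) L λ xy →
    F (λ ()) (λ ()) (good xy ∘ punchIn-injective zero _ _)
  -- The ends of each edge now need distinct colours, while its two ports may agree, so the index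
  -- labelling is enough.
  colouring | inj₂ F with greedy G (allFin (order G))
  ... | f , proper =
    colour-proper G m 2≤m f (indexLabelling G (≤-trans (s≤s z≤n) 3≤Δ)) λ {x} {y} xy →
      F (proper (∈-allFin x) (∈-allFin y) xy) (≢-sym (punchInᵢ≢i (f x) _))
        (≢-sym (punchInᵢ≢i (f y) _))
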